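{- Let $t\neq 0$, and let $D_n$ ($n\ge 0$) be the shifted derangement numbers. For every integer $n\ge 0$, $$\sum_{k=0}^n \frac{(-1)^k}{t^k} \left( \frac{D_{k+2} +(t-1)(k+2)D_{k}}{k+2}\right) = \frac{(-1)^n}{t^n}D_{n+1}.$$
   Context: The shifted derangement numbers are defined by $D_0=0$, $D_1=1$ and $D_{n+2}=(n+2)D_{n+1}+(n+2)D_n$ for $n\ge 0$; equivalently $D_n=d_{n+1}$, where $d_m$ is the number of permutations of $m$ letters with no fixed points. Here $t$ is an indeterminate, which may be specialized to any nonzero complex number. -}

module Defs where

open import Algebra.Apartness.Bundles using (HeytingCommutativeRing; HeytingField)
open import Algebra.Bundles using (CommutativeRing; Semiring)
open import Data.Fin.Base using (toℕ)
open import Data.Nat.Base as ℕ using (ℕ; zero; suc; NonZero)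
open import Data.Product.Base using (proj₁)

-- Shifted derangement numbers: D n is the number of fixed-point-free
-- permutations of n + 1 letters.
D : ℕ → ℕ
D zero          = 0
D (suc zero)    = 1
D (suc (suc n)) = (2 ℕ.+ n) ℕ.* D (suc n) ℕ.+ (2 ℕ.+ n) ℕ.* D n

-- Constructive fields: nonzero means apart from zero. Over a discrete field,
-- with x # y taken to be ¬ (x ≈ y), this is the usual notion.
module FieldNotation {c ℓ₁ ℓ₂} (F : HeytingField c ℓ₁ ℓ₂) where

  open HeytingField F
  open HeytingCommutativeRing heytingCommutativeRing using (commutativeRing)
  open CommutativeRing commutativeRing using (semiring)
  open Semiring semiring using (rawSemiring)
  open import Algebra.Definitions.RawSemiring rawSemiring
    public using (_×_; _^_; sum)
  open import Algebra.Apartness.Properties.HeytingCommutativeRing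
    heytingCommutativeRing using (1#0; x#0y#0→xy#0)

  ι : ℕ → Carrier
  ι n = n × 1#

  CharacteristicZero : Set ℓ₂
  CharacteristicZero = ∀ n .{{_ : NonZero n}} → ι n # 0#

  -- The library's #⇒invertible provides an inverse of y - 0#, which is ≈ y.
  infixl 7 _/_[_]
  _/_[_] : (x y : Carrier) → y # 0# → Carrier
  x / y [ y#0 ] = x * proj₁ (#⇒invertible y#0)

  ^-#0 : ∀ {x} → x # 0# → ∀ k → x ^ k # 0#
  ^-#0 x#0 zero    = 1#0
  ^-#0 x#0 (suc k) = x#0y#0→xy#0 x#0 (^-#0 x#0 k)

  -- ∑[0≤k≤ n ] f is f 0 + … + f n, both end points included.
  ∑[0≤k≤_] : ℕ → (ℕ → Carrier) → Carrier
  ∑[0≤k≤ n ] f = sum {suc n} (λ i → f (toℕ i))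

-- Dividing the recurrence by k + 2 turns the bracket into D (k + 1) + t D k.
-- With s k = (-1)^k / t^k we have - s (k + 1) t = s k, so the k-th summand is
-- the increment T (k + 1) - T k of T k = - s k t D k, and the sum telescopes
-- from T 0 = 0.
module Submission where

open import Defs
open import Algebra.Apartness.Bundles using (HeytingCommutativeRing; HeytingField)
open import Algebra.Bundles using (CommutativeRing)
open import Data.Fin.Base using (toℕ)
open import Data.Nat.Base as ℕ using (ℕ; zero; suc)
open import Data.Product.Base using (proj₁; proj₂)
import Algebra.Apartness.Properties.HeytingCommutativeRing as HeytingProperties
import Algebra.Properties.Group as GroupProperties
import Algebra.Properties.Ring as RingProperties
import Algebra.Properties.Semiring.Mult as Mult
import Algebra.Solver.Ring.NaturalCoefficients.Default as NaturalSolver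
import Relation.Binary.Reasoning.Setoid as SetoidReasoning

module FieldLemmas {c ℓ₁ ℓ₂} (F : HeytingField c ℓ₁ ℓ₂) where

  open HeytingField F
  open FieldNotation F
  open HeytingCommutativeRing heytingCommutativeRing using (commutativeRing)
  open CommutativeRing commutativeRing
    using (semiring; commutativeSemiring; ring; +-group)
  open HeytingProperties heytingCommutativeRing using (x-0≈x)
  open GroupProperties +-group using () renaming (⁻¹-involutive to -‿involutive)
  open RingProperties ring using (-‿distribˡ-*; -1*x≈-x)
  open Mult semiring using (×-homo-+; ×1-homo-*)
  open NaturalSolver commutativeSemiring using (solve; _:=_; _:+_; _:*_)
  open SetoidReasoning setoid

  x/y*y≈x : ∀ x {y} (y#0 : y # 0#) → (x / y [ y#0 ]) * y ≈ x
  x/y*y≈x x {y} y#0 = begin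
    x * y⁻¹ * y           ≈⟨ *-assoc x y⁻¹ y ⟩
    x * (y⁻¹ * y)         ≈⟨ *-congˡ (*-congˡ (x-0≈x y)) ⟨
    x * (y⁻¹ * (y - 0#))  ≈⟨ *-congˡ (proj₁ (proj₂ (#⇒invertible y#0))) ⟩
    x * 1#                ≈⟨ *-identityʳ x ⟩
    x                     ∎
    where y⁻¹ = proj₁ (#⇒invertible y#0)

  z*y/y≈z : ∀ z {y} (y#0 : y # 0#) → ((z * y) / y [ y#0 ]) ≈ z
  z*y/y≈z z {y} y#0 = begin
    z * y * y⁻¹           ≈⟨ *-assoc z y y⁻¹ ⟩
    z * (y * y⁻¹)         ≈⟨ *-congˡ (*-congʳ (x-0≈x y)) ⟨
    z * ((y - 0#) * y⁻¹)  ≈⟨ *-congˡ (proj₂ (proj₂ (#⇒invertible y#0))) ⟩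
    z * 1#                ≈⟨ *-identityʳ z ⟩
    z                     ∎
    where y⁻¹ = proj₁ (#⇒invertible y#0)

  -- Lets a quotient be identified by a multiplication alone. It serves both for the powers of `t`
  -- and for the division by `k + 2`.
  /-unique : ∀ {x y z} (y#0 : y # 0#) → x ≈ z * y → x / y [ y#0 ] ≈ z
  /-unique {z = z} y#0 x≈zy = trans (*-congʳ x≈zy) (z*y/y≈z z y#0)

  -- `sum` unfolds from its first term, so the induction absorbs `f 0` into `T 0` and continues with
  -- both sequences shifted by one.
  telescope : ∀ (T f : ℕ → Carrier) → (∀ k → T k + f k ≈ T (suc k)) →
              ∀ n → T 0 + sum {n} (λ i → f (toℕ i)) ≈ T n
  telescope T f step zero    = +-identityʳ (T 0)
  telescope T f step (suc n) = begin
    T 0 + (f 0 + rest)  ≈⟨ +-assoc (T 0) (f 0) rest ⟨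
    T 0 + f 0 + rest    ≈⟨ +-congʳ (step 0) ⟩
    T 1 + rest          ≈⟨ telescope (λ k → T (suc k)) (λ k → f (suc k))
                                     (λ k → step (suc k)) n ⟩
    T (suc n)           ∎
    where rest = sum {n} (λ i → f (suc (toℕ i)))

  ι-D-rec : ∀ k → ι (D (2 ℕ.+ k)) ≈ ι (2 ℕ.+ k) * ι (D (suc k)) + ι (2 ℕ.+ k) * ι (D k)
  ι-D-rec k = trans
    (×-homo-+ 1# ((2 ℕ.+ k) ℕ.* D (suc k)) ((2 ℕ.+ k) ℕ.* D k))
    (+-cong (×1-homo-* (2 ℕ.+ k) (D (suc k))) (×1-homo-* (2 ℕ.+ k) (D k)))

  x-y+y≈x : ∀ x y → x - y + y ≈ x
  x-y+y≈x x y = begin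
    x - y + y      ≈⟨ +-assoc x (- y) y ⟩
    x + (- y + y)  ≈⟨ +-congˡ (-‿inverseˡ y) ⟩
    x + 0#         ≈⟨ +-identityʳ x ⟩
    x              ∎

  -- The recurrence makes `k + 2` a common factor, and its term in `D k` cancels the `- 1#` of
  -- `t - 1#`.
  bracket-numerator : ∀ t k →
    ι (D (2 ℕ.+ k)) + (t - 1#) * ι (2 ℕ.+ k) * ι (D k)
      ≈ (ι (D (suc k)) + t * ι (D k)) * ι (2 ℕ.+ k)
  bracket-numerator t k = begin
    ι (D (2 ℕ.+ k)) + u * a * y  ≈⟨ +-congʳ (ι-D-rec k) ⟩
    a * x + a * y + u * a * y    ≈⟨ regroup ⟩
    (x + (u + 1#) * y) * a       ≈⟨ *-congʳ (+-congˡ (*-congʳ (x-y+y≈x t 1#))) ⟩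
    (x + t * y) * a              ∎
    where
    a = ι (2 ℕ.+ k)
    x = ι (D (suc k))
    y = ι (D k)
    u = t - 1#

    regroup : a * x + a * y + u * a * y ≈ (x + (u + 1#) * y) * a
    regroup = begin
      a * x + a * y + u * a * y
        -- The solver handles commutative semirings, so the difference `t - 1#` enters as the atom
        -- `u`.
        ≈⟨ solve 4 (λ a x y u → a :* x :+ a :* y :+ u :* a :* y
                              := (x :+ (u :* y :+ y)) :* a) refl a x y u ⟩
      (x + (u * y + y)) * a
        ≈⟨ *-congʳ (+-congˡ (+-congˡ (*-identityˡ y))) ⟨
      (x + (u * y + 1# * y)) * a
        ≈⟨ *-congʳ (+-congˡ (distribʳ y u 1#)) ⟨
      (x + (u + 1#) * y) * a
        ∎

  module _ (t : Carrier) (t#0 : t # 0#) where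

    signedPower : ℕ → Carrier
    signedPower k = (- 1#) ^ k / t ^ k [ ^-#0 t#0 k ]

    -- By `/-unique` it is enough to multiply by `t ^ k`: the extra factor `t` completes the
    -- denominator `t ^ suc k`, and the outer sign cancels the additional `- 1#` in the numerator.
    -signedPower-suc*t : ∀ k → - (signedPower (suc k) * t) ≈ signedPower k
    -signedPower-suc*t k = sym (/-unique (^-#0 t#0 k) (begin
      p                    ≈⟨ -‿involutive p ⟨
      - (- p)              ≈⟨ -‿cong (-1*x≈-x p) ⟨
      - (- 1# * p)         ≈⟨ -‿cong (x/y*y≈x (- 1# * p) (^-#0 t#0 (suc k))) ⟨
      - (s * (t * t ^ k))  ≈⟨ -‿cong (*-assoc s t (t ^ k)) ⟨
      - (s * t * t ^ k)    ≈⟨ -‿distribˡ-* (s * t) (t ^ k) ⟩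
      - (s * t) * t ^ k    ∎))
      where
      p = (- 1#) ^ k
      s = signedPower (suc k)

    -- For positive `k` this is `signedPower (k - 1) * ι (D k)`, the claimed value of the sum of the
    -- first `k` terms. Writing it with the factor `t` avoids the predecessor and also covers the
    -- empty sum at `k = 0`.
    partialSum : ℕ → Carrier
    partialSum k = - (signedPower k * t) * ι (D k)

    partialSum-suc : ∀ k → partialSum (suc k) ≈ signedPower k * ι (D (suc k))
    partialSum-suc k = *-congʳ (-signedPower-suc*t k)

    partialSum-step : ∀ k →
      partialSum k + signedPower k * (ι (D (suc k)) + t * ι (D k)) ≈ partialSum (suc k)
    partialSum-step k = begin
      - (s * t) * y + s * (x + t * y)
        -- The atom `m` stands for `- (s * t)`; its cancellation against `s * t` is left to the next
        -- step.
        ≈⟨ solve 5 (λ s t x y m → m :* y :+ s :* (x :+ t :* y)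
                                := s :* x :+ (m :+ s :* t) :* y)
                   refl s t x y (- (s * t)) ⟩
      s * x + (- (s * t) + s * t) * y  ≈⟨ +-congˡ (*-congʳ (-‿inverseˡ (s * t))) ⟩
      s * x + 0# * y                   ≈⟨ +-congˡ (zeroˡ y) ⟩
      s * x + 0#                       ≈⟨ +-identityʳ (s * x) ⟩
      s * x                            ≈⟨ partialSum-suc k ⟨
      partialSum (suc k)               ∎
      where
      s = signedPower k
      x = ι (D (suc k))
      y = ι (D k)

    module _ (char0 : CharacteristicZero) where

      summand : ℕ → Carrier
      summand k =
        signedPower k
        * ((ι (D (2 ℕ.+ k)) + (t - 1#) * ι (2 ℕ.+ k) * ι (D k))
             / ι (2 ℕ.+ k) [ char0 (2 ℕ.+ k) ])

      ∑-summand : ∀ n → ∑[0≤k≤ n ] summand ≈ signedPower n * ι (D (suc n))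
      ∑-summand n = begin
        ∑[0≤k≤ n ] summand                 ≈⟨ +-identityˡ _ ⟨
        -- `ι (D 0)` computes to `0#`, so `partialSum 0` vanishes.
        0# + ∑[0≤k≤ n ] summand            ≈⟨ +-congʳ (zeroʳ (- (signedPower 0 * t))) ⟨
        -- Both end points are included, hence `suc n` terms.
        partialSum 0 + ∑[0≤k≤ n ] summand  ≈⟨ telescope partialSum summand step (suc n) ⟩
        partialSum (suc n)                 ≈⟨ partialSum-suc n ⟩
        signedPower n * ι (D (suc n))      ∎
        where
        step : ∀ k → partialSum k + summand k ≈ partialSum (suc k)
        step k = trans
          (+-congˡ (*-congˡ (/-unique (char0 (2 ℕ.+ k)) (bracket-numerator t k))))
          (partialSum-step k)

mainTheorem9 :
    ∀ {c ℓ₁ ℓ₂} (F : HeytingField c ℓ₁ ℓ₂) →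
    let open HeytingField F
        open FieldNotation F
    in (char0 : CharacteristicZero) (t : Carrier) (t#0 : t # 0#) (n : ℕ) →
       ∑[0≤k≤ n ] (λ k →
         ((- 1#) ^ k / t ^ k [ ^-#0 t#0 k ])
         * ((ι (D (2 ℕ.+ k)) + (t - 1#) * ι (2 ℕ.+ k) * ι (D k))
              / ι (2 ℕ.+ k) [ char0 (2 ℕ.+ k) ]))
       ≈ ((- 1#) ^ n / t ^ n [ ^-#0 t#0 n ]) * ι (D (suc n))
mainTheorem9 F char0 t t#0 n = FieldLemmas.∑-summand F t t#0 char0 n
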